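{- Let $S(\ell_1,\dots,\ell_k)$ be a spider tree with $k\ge3$ and $1\le\ell_1\le\cdots\le\ell_k$, and let $n=1+\sum_{i=1}^k\ell_i$ be its number of vertices. Set $R=n-1-\ell_k$ and $$H=\begin{cases}\ell_k/2, & \ell_k\text{ even},\\ n-(\ell_k+1)/2, & \ell_k\text{ odd}.\end{cases}$$ Suppose the hub receives label $H$ and the vertices of the arm of length $\ell_k$, in order going outward from the hub, are labeled by $$\mathrm{arm\_walk}\bigl(H,(n-\ell_k,n-\ell_k+1,\dots,n-1),\varepsilon,n\bigr),$$ with $\varepsilon=+1$ if $\ell_k$ is even and $\varepsilon=-1$ if $\ell_k$ is odd. Then that arm uses exactly the differences $\{n-\ell_k,\dots,n-1\}$. The unused labels (the elements of $\{0,\dots,n-1\}$ not used on the hub or on this arm) form one interval of integers $[A,B]$ of size $R$, adjacent to the hub label: $H=A-1$ when $\ell_k$ is even and $H=B+1$ when $\ell_k$ is odd. The remaining differences (the elements of $\{1,\dots,n-1\}$ not used on this arm) are $\{1,\dots,R\}$.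
   Context: The spider tree $S(\ell_1,\dots,\ell_k)$ is obtained from a central hub vertex by attaching $k$ paths (arms) at the hub, where $\ell_i$ is the number of edges of the $i$-th arm. Given a starting label $c\in[0,n)$, an ordered list of differences $D=(d_0,d_1,\dots,d_{p-1})$ and an initial sign $\varepsilon\in\{+1,-1\}$, define $x_0=c$ and $x_{i+1}=x_i+(-1)^i\varepsilon d_i$ for $i=0,\dots,p-1$; then $\mathrm{arm\_walk}(c,D,\varepsilon,n)=(x_1,\dots,x_p)$. The differences used by an arm are the absolute differences of labels along its edges, including the edge from the hub to the first vertex of the arm. -}

module Defs where

open import Data.Bool.Base using (if_then_else_)
open import Data.Fin.Base using (Fin; zero; suc; inject₁; toℕ)
open import Data.Integer.Base as ℤ using (ℤ; +_; -1ℤ; _◃_; ∣_∣)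
open import Data.Nat.Base as ℕ using (ℕ; suc; _∸_; _/_)
open import Data.Nat.Divisibility using (_∣?_)
open import Data.Product.Base using (_×_; ∃)
open import Data.Sign.Base as Sign using (Sign)
open import Data.Vec.Base using (Vec; []; _∷_; tabulate)
open import Data.Vec.Functional using (Vector; foldr)
open import Level using (0ℓ)
open import Relation.Binary.PropositionalEquality.Core using (_≡_)
open import Relation.Nullary.Decidable.Core using (does)
open import Relation.Unary using (Pred)

-- Vertices of the spider tree S(ℓ₁,…,ℓₖ); `arm i j` is the vertex at
-- distance 1 + j from the hub on arm i.
data Vertex {k : ℕ} (ℓ : Vector ℕ k) : Set where
  hub : Vertex ℓ
  arm : (i : Fin k) → Fin (ℓ i) → Vertex ℓ

order : {k : ℕ} → Vector ℕ k → ℕ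
order ℓ = 1 ℕ.+ foldr ℕ._+_ 0 ℓ

-- The path formed by the hub followed by arm i.
path : {k : ℕ} {ℓ : Vector ℕ k} (i : Fin k) → Fin (suc (ℓ i)) → Vertex ℓ
path i zero    = hub
path i (suc j) = arm i j

-- Labels are arbitrary integers: membership in {0,…,n-1} and injectivity are
-- not assumed.
Labelling : {k : ℕ} → Vector ℕ k → Set
Labelling ℓ = Vertex ℓ → ℤ

-- Labels used on the hub or on arm i.
UsedLabel : {k : ℕ} {ℓ : Vector ℕ k} → Labelling ℓ → Fin k → Pred ℤ 0ℓ
UsedLabel f i x = ∃ λ j → f (path i j) ≡ x

-- The edges of arm i are indexed by Fin (ℓ i); edge 0 is incident to the hub.
UsedDifference : {k : ℕ} {ℓ : Vector ℕ k} → Labelling ℓ → Fin k → Pred ℕ 0ℓ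
UsedDifference {ℓ = ℓ} f i d =
  ∃ λ (j : Fin (ℓ i)) → ∣ f (path i (suc j)) ℤ.- f (path i (inject₁ j)) ∣ ≡ d

[_⋯_]ℤ : ℤ → ℤ → Pred ℤ 0ℓ
[ a ⋯ b ]ℤ x = a ℤ.≤ x × x ℤ.≤ b

[_⋯_]ℕ : ℕ → ℕ → Pred ℕ 0ℓ
[ a ⋯ b ]ℕ d = a ℕ.≤ d × d ℕ.≤ b

-- From x = xᵢ and the remaining differences (dᵢ, dᵢ₊₁, …), the list
-- (xᵢ₊₁, xᵢ₊₂, …) with xᵢ₊₁ = xᵢ + (-1)ⁱ ε dᵢ.
walkFrom : {p : ℕ} (i : ℕ) (x : ℤ) → Vec ℕ p → Sign → Vec ℤ p
walkFrom i x []      ε = []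
walkFrom i x (d ∷ D) ε = y ∷ walkFrom (suc i) y D ε
  where y = x ℤ.+ (-1ℤ ℤ.^ i) ℤ.* (ε ◃ d)

-- The argument n only records the intended range 0 ≤ c < n of the starting
-- label; the walk does not depend on it.
armWalk : {p : ℕ} (c : ℤ) → Vec ℕ p → Sign → (n : ℕ) → Vec ℤ p
armWalk c D ε n = walkFrom 0 c D ε

-- In the next two definitions L is the length of the longest arm.  Both
-- divisions are exact in the branch where they occur.
hubLabel : (n L : ℕ) → ℤ
hubLabel n L =
  if does (2 ∣? L) then + (L / 2) else + n ℤ.- + ((L ℕ.+ 1) / 2)

initialSign : (L : ℕ) → Sign
initialSign L = if does (2 ∣? L) then Sign.+ else Sign.-

-- (n - L, n - L + 1, …, n - 1)
topDifferences : (n L : ℕ) → Vec ℕ L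
topDifferences n L = tabulate λ j → (n ∸ L) ℕ.+ toℕ j

{-# OPTIONS --safe #-}

-- Put L = ℓ last and R = n - 1 - L, and let h = ⌊L / 2⌋.  Two consecutive
-- steps of the walk, of sizes d and d + 1 and opposite signs, move it by one,
-- so the labels in even and in odd positions form two monotone runs.  For
-- either parity of L, one run descends from h to 0 and the other ascends from
-- h + R + 1 to n - 1; the gap between them is [h + 1, h + R].  The hub is the
-- start of the descending run when L is even and of the ascending one when L
-- is odd.
module Submission where

open import Defs
open import Data.Bool.Base using (if_then_else_)
open import Data.Fin.Base as Fin using (Fin; zero; suc; fromℕ; fromℕ<; inject₁; toℕ)
open import Data.Fin.Induction using (<-weakInduction)
open import Data.Fin.Properties using (toℕ-fromℕ<; toℕ-inject₁; toℕ<n; toℕ≤pred[n])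
open import Data.Integer.Base as ℤ using (ℤ; +_; +≤+; 0ℤ; 1ℤ; -1ℤ; _◃_; ∣_∣)
import Data.Integer.Properties as ℤₚ
import Data.Integer.Tactic.RingSolver as ℤ-Solver
open import Data.Nat.Base as ℕ using (ℕ; suc; _∸_; z≤n; s≤s)
open import Data.Nat.Divisibility using (_∣_; _∣?_; divides; ∣m+n∣m⇒∣n; ∣1⇒≡1)
open import Data.Nat.DivMod using (m*n/n≡m)
import Data.Nat.Properties as ℕₚ
import Data.Nat.Tactic.RingSolver as ℕ-Solver
open import Data.Product.Base using (_×_; _,_; ∃; ∃₂)
open import Data.Sign.Base as Sign using (Sign)
open import Data.Sum.Base using (_⊎_; inj₁; inj₂)
open import Data.Vec.Base using (Vec; _∷_; lookup; tabulate)
open import Data.Vec.Functional using (Vector; foldr)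
open import Data.Vec.Properties using (∷-injective; lookup∘tabulate)
open import Function.Base using (_∘_)
open import Level using (0ℓ)
open import Relation.Binary.PropositionalEquality
open import Relation.Nullary.Decidable using (dec-true; dec-false)
open import Relation.Nullary.Negation.Core using (¬_; contradiction)
open import Relation.Unary using (Pred; _≐_; _∩_; _∪_; ∁)

-- Parity, powers of -1 and integer subtraction.

parity : ∀ n → ∃ λ t → n ≡ t ℕ.* 2 ⊎ n ≡ suc (t ℕ.* 2)
parity 0 = 0 , inj₁ refl
parity (suc n) with parity n
... | t , inj₁ eq = t , inj₂ (cong suc eq)
... | t , inj₂ eq = suc t , inj₁ (cong suc eq)

2∤1+n*2 : ∀ n → ¬ (2 ∣ suc (n ℕ.* 2))
2∤1+n*2 n 2∣ with () ← ∣1⇒≡1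
  (∣m+n∣m⇒∣n (subst (2 ∣_) (ℕₚ.+-comm 1 (n ℕ.* 2)) 2∣) (divides n refl))

lookup≤foldr-+ : ∀ {k} (xs : Vector ℕ k) i → xs i ℕ.≤ foldr ℕ._+_ 0 xs
lookup≤foldr-+ xs zero    = ℕₚ.m≤m+n _ _
lookup≤foldr-+ xs (suc i) = ℕₚ.m≤n⇒m≤o+n (xs zero) (lookup≤foldr-+ (xs ∘ suc) i)

∣-1^n∣≡1 : ∀ n → ∣ -1ℤ ℤ.^ n ∣ ≡ 1
∣-1^n∣≡1 0       = refl
∣-1^n∣≡1 (suc n) = trans (ℤₚ.abs-* -1ℤ (-1ℤ ℤ.^ n)) (cong (1 ℕ.*_) (∣-1^n∣≡1 n))

-1^[n*2]≡1 : ∀ n → -1ℤ ℤ.^ (n ℕ.* 2) ≡ 1ℤ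
-1^[n*2]≡1 0       = refl
-1^[n*2]≡1 (suc n) = cong (λ i → -1ℤ ℤ.* (-1ℤ ℤ.* i)) (-1^[n*2]≡1 n)

[m+n]-n≡m : ∀ m n → + (m ℕ.+ n) ℤ.- + n ≡ + m
[m+n]-n≡m m n = solve (+ m) (+ n)
  where
  solve : ∀ i j → i ℤ.+ j ℤ.- j ≡ i
  solve = ℤ-Solver.solve-∀

m-n≡m∸n : ∀ {m n} → n ℕ.≤ m → + m ℤ.- + n ≡ + (m ∸ n)
m-n≡m∸n {m} {n} n≤m = trans (ℤₚ.m-n≡m⊖n m n) (ℤₚ.⊖-≥ n≤m)

-- Closed form of a walk with consecutive differences.

step : Sign → ℕ → ℕ → ℤ
step ε d i = (-1ℤ ℤ.^ i) ℤ.* (ε ◃ (d ℕ.+ i))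

-- The walk as a function of an unbounded index, so that positions `t * 2` and `suc (t * 2)` can be
-- named without range proofs.
zigzag : ℤ → Sign → ℕ → ℕ → ℤ
zigzag c ε d 0       = c
zigzag c ε d (suc i) = zigzag c ε d i ℤ.+ step ε d i

∣step∣ : ∀ ε d i → ∣ step ε d i ∣ ≡ d ℕ.+ i
∣step∣ ε d i = begin
  ∣ step ε d i ∣                              ≡⟨ ℤₚ.abs-* (-1ℤ ℤ.^ i) _ ⟩
  ∣ -1ℤ ℤ.^ i ∣ ℕ.* ∣ ε ◃ (d ℕ.+ i) ∣          ≡⟨ cong₂ ℕ._*_ (∣-1^n∣≡1 i) (ℤₚ.abs-◃ ε _) ⟩
  1 ℕ.* (d ℕ.+ i)                             ≡⟨ ℕₚ.*-identityˡ _ ⟩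
  d ℕ.+ i                                     ∎
  where open ≡-Reasoning

-- Mutual induction, each position from the one before it. The step sizes split as `(d + t) + t`
-- into an odd position and `(d + t) + suc t` out of it, and `◃` distributes over the sum: the part
-- `d + t` is added and then removed again.
zigzag-even : ∀ c ε d t → zigzag c ε d (t ℕ.* 2) ≡ c ℤ.- (ε ◃ t)
zigzag-odd  : ∀ c ε d t → zigzag c ε d (suc (t ℕ.* 2)) ≡ c ℤ.+ (ε ◃ (d ℕ.+ t))

zigzag-even c ε d 0       = sym (ℤₚ.+-identityʳ c)
zigzag-even c ε d (suc t) = begin
  zigzag c ε d (suc (t ℕ.* 2)) ℤ.+ step ε d (suc (t ℕ.* 2))
    ≡⟨ cong₂ ℤ._+_ (zigzag-odd c ε d t)
         (cong₂ (λ i m → -1ℤ ℤ.* i ℤ.* (ε ◃ m)) (-1^[n*2]≡1 t) (rearrange d t)) ⟩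
  c ℤ.+ (ε ◃ (d ℕ.+ t)) ℤ.+ -1ℤ ℤ.* (ε ◃ (d ℕ.+ t ℕ.+ suc t))
    ≡⟨ cong (λ i → c ℤ.+ (ε ◃ (d ℕ.+ t)) ℤ.+ -1ℤ ℤ.* i) (ℤₚ.◃-distrib-+ ε (d ℕ.+ t) (suc t)) ⟩
  c ℤ.+ (ε ◃ (d ℕ.+ t)) ℤ.+ -1ℤ ℤ.* ((ε ◃ (d ℕ.+ t)) ℤ.+ (ε ◃ suc t))
    ≡⟨ cancel c (ε ◃ (d ℕ.+ t)) (ε ◃ suc t) ⟩
  c ℤ.- (ε ◃ suc t) ∎
  where
  open ≡-Reasoning
  rearrange : ∀ d t → d ℕ.+ suc (t ℕ.* 2) ≡ d ℕ.+ t ℕ.+ suc t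
  rearrange = ℕ-Solver.solve-∀
  cancel : ∀ x y z → x ℤ.+ y ℤ.+ -1ℤ ℤ.* (y ℤ.+ z) ≡ x ℤ.- z
  cancel = ℤ-Solver.solve-∀

zigzag-odd c ε d t = begin
  zigzag c ε d (t ℕ.* 2) ℤ.+ step ε d (t ℕ.* 2)
    ≡⟨ cong₂ ℤ._+_ (zigzag-even c ε d t)
         (cong₂ (λ i m → i ℤ.* (ε ◃ m)) (-1^[n*2]≡1 t) (rearrange d t)) ⟩
  c ℤ.- (ε ◃ t) ℤ.+ 1ℤ ℤ.* (ε ◃ (d ℕ.+ t ℕ.+ t))
    ≡⟨ cong (λ i → c ℤ.- (ε ◃ t) ℤ.+ 1ℤ ℤ.* i) (ℤₚ.◃-distrib-+ ε (d ℕ.+ t) t) ⟩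
  c ℤ.- (ε ◃ t) ℤ.+ 1ℤ ℤ.* ((ε ◃ (d ℕ.+ t)) ℤ.+ (ε ◃ t))
    ≡⟨ cancel c (ε ◃ t) (ε ◃ (d ℕ.+ t)) ⟩
  c ℤ.+ (ε ◃ (d ℕ.+ t)) ∎
  where
  open ≡-Reasoning
  rearrange : ∀ d t → d ℕ.+ t ℕ.* 2 ≡ d ℕ.+ t ℕ.+ t
  rearrange = ℕ-Solver.solve-∀
  cancel : ∀ x y z → x ℤ.- y ℤ.+ 1ℤ ℤ.* (z ℤ.+ y) ≡ x ℤ.+ z
  cancel = ℤ-Solver.solve-∀

-- From the list of labels to the recurrence.

walkFrom-step : ∀ {p} i ε (D : Vec ℕ p) (g : Fin (suc p) → ℤ) →
  tabulate (g ∘ suc) ≡ walkFrom i (g zero) D ε →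
  ∀ j → g (suc j) ≡ g (inject₁ j) ℤ.+ (-1ℤ ℤ.^ (i ℕ.+ toℕ j)) ℤ.* (ε ◃ lookup D j)
walkFrom-step i ε (d ∷ D) g eq j with ∷-injective eq
walkFrom-step i ε (d ∷ D) g eq zero | g₁≡ , _
  rewrite ℕₚ.+-identityʳ i = g₁≡
walkFrom-step i ε (d ∷ D) g eq (suc j) | g₁≡ , rest
  rewrite ℕₚ.+-suc i (toℕ j) =
  -- The tail of the walk starts at the computed value; the head equation turns that value into
  -- `g (suc zero)`, so the induction applies to `g ∘ suc`.
  walkFrom-step (suc i) ε D (g ∘ suc)
    (trans rest (cong (λ x → walkFrom (suc i) x D ε) (sym g₁≡))) j

armWalk-step : ∀ n L ε (g : Fin (suc L) → ℤ) →
  tabulate (g ∘ suc) ≡ armWalk (g zero) (topDifferences n L) ε n →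
  ∀ j → g (suc j) ≡ g (inject₁ j) ℤ.+ step ε (n ∸ L) (toℕ j)
armWalk-step n L ε g eq j = trans (walkFrom-step 0 ε (topDifferences n L) g eq j)
  (cong (λ d → g (inject₁ j) ℤ.+ (-1ℤ ℤ.^ toℕ j) ℤ.* (ε ◃ d)) (lookup∘tabulate _ j))

steps⇒zigzag : ∀ {L} ε d (g : Fin (suc L) → ℤ) →
  (∀ j → g (suc j) ≡ g (inject₁ j) ℤ.+ step ε d (toℕ j)) →
  ∀ j → g j ≡ zigzag (g zero) ε d (toℕ j)
steps⇒zigzag ε d g steps = <-weakInduction _ refl λ j gj≡ → trans (steps j)
  (cong (ℤ._+ step ε d (toℕ j))
    (trans gj≡ (cong (zigzag (g zero) ε d) (toℕ-inject₁ j))))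

-- Used labels and used differences as images.

Image : ∀ {n} {A : Set} → (Fin n → A) → Pred A 0ℓ
Image g x = ∃ λ j → g j ≡ x

-- For `g = f ∘ path i`, `Image g` and `Difference g` unfold to `UsedLabel f i` and
-- `UsedDifference f i`.
Difference : ∀ {L} → (Fin (suc L) → ℤ) → Pred ℕ 0ℓ
Difference g = Image λ j → ∣ g (suc j) ℤ.- g (inject₁ j) ∣

Image-toℕ : ∀ {L} {A : Set} (g : Fin (suc L) → A) (z : ℕ → A) →
  (∀ j → g j ≡ z (toℕ j)) → ∀ i → i ℕ.≤ L → Image g (z i)
Image-toℕ g z g≡ i i≤L = fromℕ< (s≤s i≤L) , trans (g≡ _) (cong z (toℕ-fromℕ< (s≤s i≤L)))

-- Signs vanish under the absolute value, so edge `j` has difference exactly `suc d + j`, and `j`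
-- runs through 0, ..., L - 1.
Differences-zigzag : ∀ {L} ε d (g : Fin (suc L) → ℤ) →
  (∀ j → g (suc j) ≡ g (inject₁ j) ℤ.+ step ε (suc d) (toℕ j)) →
  Difference g ≐ [ suc d ⋯ d ℕ.+ L ]ℕ
Differences-zigzag {L} ε d g steps = to , from
  where
  diff : ∀ j → ∣ g (suc j) ℤ.- g (inject₁ j) ∣ ≡ suc d ℕ.+ toℕ j
  diff j rewrite steps j = trans (cong ∣_∣ (cancel (g (inject₁ j)) _)) (∣step∣ ε (suc d) (toℕ j))
    where
    cancel : ∀ x y → x ℤ.+ y ℤ.- x ≡ y
    cancel = ℤ-Solver.solve-∀
  to : ∀ {x} → Difference g x → [ suc d ⋯ d ℕ.+ L ]ℕ x
  to (j , refl) rewrite diff j =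
    ℕₚ.m≤m+n (suc d) _ , subst (ℕ._≤ d ℕ.+ L) (ℕₚ.+-suc d _) (ℕₚ.+-monoʳ-≤ d (toℕ<n j))
  from : ∀ {x} → [ suc d ⋯ d ℕ.+ L ]ℕ x → Difference g x
  from {x} (d<x , x≤d+L) = fromℕ< i<L ,
    trans (diff _) (trans (cong (suc d ℕ.+_) (toℕ-fromℕ< i<L)) (ℕₚ.m+[n∸m]≡n d<x))
    where
    i<L : x ∸ suc d ℕ.< L
    i<L = ℕₚ.+-cancelˡ-≤ d _ _ (subst (ℕ._≤ d ℕ.+ L)
      (sym (trans (ℕₚ.+-suc d _) (ℕₚ.m+[n∸m]≡n d<x))) x≤d+L)

-- The two runs of labels and the gap between them.

Descending : ℕ → Pred ℤ 0ℓ
Descending h x = ∃ λ t → t ℕ.≤ h × x ≡ + (h ∸ t)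

-- Both runs are parametrised by `t`, half the position in the walk rounded down, rather than given
-- as intervals. `Descending h` has `suc h` labels, `Ascending b q` has `q`.
Ascending : ℕ → ℕ → Pred ℤ 0ℓ
Ascending b q x = ∃ λ t → t ℕ.< q × x ≡ + (b ℕ.+ t)

module _ (R h : ℕ) where

  -- The value of n - (L + 1) / 2 for L = 2h + 1 and n = R + L + 1.
  oddHub : ℤ
  oddHub = + suc (h ℕ.+ R)

  evenWalk oddWalk : ℕ → ℤ
  evenWalk = zigzag (+ h) Sign.+ (suc R)
  oddWalk  = zigzag oddHub Sign.- (suc R)

  evenWalk-even : ∀ {t} → t ℕ.≤ h → evenWalk (t ℕ.* 2) ≡ + (h ∸ t)
  evenWalk-even {t} t≤h = trans (zigzag-even (+ h) Sign.+ (suc R) t)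
    (trans (cong (λ i → + h ℤ.- i) (ℤₚ.+◃n≡+n t)) (m-n≡m∸n t≤h))

  evenWalk-odd : ∀ t → evenWalk (suc (t ℕ.* 2)) ≡ + (suc (h ℕ.+ R) ℕ.+ t)
  evenWalk-odd t = trans (zigzag-odd (+ h) Sign.+ (suc R) t)
    (cong +_ (rearrange h R t))
    where
    rearrange : ∀ h R t → h ℕ.+ (suc R ℕ.+ t) ≡ suc (h ℕ.+ R) ℕ.+ t
    rearrange = ℕ-Solver.solve-∀

  oddWalk-even : ∀ t → oddWalk (t ℕ.* 2) ≡ + (suc (h ℕ.+ R) ℕ.+ t)
  oddWalk-even t = trans (zigzag-even oddHub Sign.- (suc R) t)
    (cong (ℤ._+_ oddHub) (trans (cong ℤ.-_ (ℤₚ.-◃n≡-n t)) (ℤₚ.neg-involutive (+ t))))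

  oddWalk-odd : ∀ {t} → t ℕ.≤ h → oddWalk (suc (t ℕ.* 2)) ≡ + (h ∸ t)
  oddWalk-odd {t} t≤h = trans (zigzag-odd oddHub Sign.- (suc R) t)
    (trans (cancel (+ h) (+ R) (+ t)) (m-n≡m∸n t≤h))
    where
    cancel : ∀ x y z → 1ℤ ℤ.+ (x ℤ.+ y) ℤ.- (1ℤ ℤ.+ (y ℤ.+ z)) ≡ x ℤ.- z
    cancel = ℤ-Solver.solve-∀

  -- Among positions 0, ..., 2h the even ones give the descending run and the h odd ones the
  -- ascending run.
  evenWalk-image : (g : Fin (suc (h ℕ.* 2)) → ℤ) →
    (∀ j → g j ≡ evenWalk (toℕ j)) →
    Image g ≐ Descending h ∪ Ascending (suc (h ℕ.+ R)) h
  evenWalk-image g g≡ = to , from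
    where
    to : ∀ {x} → Image g x → (Descending h ∪ Ascending (suc (h ℕ.+ R)) h) x
    to (j , refl) with parity (toℕ j) | toℕ≤pred[n] j
    ... | t , inj₁ eq | j≤ = inj₁ (t , t≤h ,
            trans (g≡ j) (trans (cong evenWalk eq) (evenWalk-even t≤h)))
      where t≤h = ℕₚ.*-cancelʳ-≤ t h 2 (subst (ℕ._≤ h ℕ.* 2) eq j≤)
    ... | t , inj₂ eq | j≤ = inj₂ (t , ℕₚ.*-cancelʳ-< 2 t h (subst (ℕ._≤ h ℕ.* 2) eq j≤) ,
            trans (g≡ j) (trans (cong evenWalk eq) (evenWalk-odd t)))
    from : ∀ {x} → (Descending h ∪ Ascending (suc (h ℕ.+ R)) h) x → Image g x
    from (inj₁ (t , t≤h , refl)) = subst (Image g) (evenWalk-even t≤h)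
      (Image-toℕ g evenWalk g≡ _ (ℕₚ.*-monoˡ-≤ 2 t≤h))
    from (inj₂ (t , t<h , refl)) = subst (Image g) (evenWalk-odd t)
      (Image-toℕ g evenWalk g≡ _ (ℕₚ.*-monoˡ-< 2 t<h))

  -- The roles of the parities are exchanged: positions 0, ..., 2h + 1 contain `suc h` of each
  -- parity, and the hub is the entry `t = 0` of the ascending run.
  oddWalk-image : (g : Fin (suc (suc (h ℕ.* 2))) → ℤ) →
    (∀ j → g j ≡ oddWalk (toℕ j)) →
    Image g ≐ Descending h ∪ Ascending (suc (h ℕ.+ R)) (suc h)
  oddWalk-image g g≡ = to , from
    where
    to : ∀ {x} → Image g x → (Descending h ∪ Ascending (suc (h ℕ.+ R)) (suc h)) x
    to (j , refl) with parity (toℕ j) | toℕ≤pred[n] j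
    ... | t , inj₁ eq | j≤ =
            -- `suc (suc (h * 2))` is `suc h * 2` by definition, so the bound reads
            -- `t * 2 < suc h * 2`.
            inj₂ (t , ℕₚ.*-cancelʳ-< 2 t (suc h) (s≤s (subst (ℕ._≤ suc (h ℕ.* 2)) eq j≤)) ,
            trans (g≡ j) (trans (cong oddWalk eq) (oddWalk-even t)))
    ... | t , inj₂ eq | j≤ = inj₁ (t , t≤h ,
            trans (g≡ j) (trans (cong oddWalk eq) (oddWalk-odd t≤h)))
      where t≤h = ℕₚ.*-cancelʳ-≤ t h 2 (ℕ.s≤s⁻¹ (subst (ℕ._≤ suc (h ℕ.* 2)) eq j≤))
    from : ∀ {x} → (Descending h ∪ Ascending (suc (h ℕ.+ R)) (suc h)) x → Image g x
    from (inj₁ (t , t≤h , refl)) = subst (Image g) (oddWalk-odd t≤h)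
      (Image-toℕ g oddWalk g≡ _ (s≤s (ℕₚ.*-monoˡ-≤ 2 t≤h)))
    from (inj₂ (t , s≤s t≤h , refl)) = subst (Image g) (oddWalk-even t)
      (Image-toℕ g oddWalk g≡ _ (ℕₚ.m≤n⇒m≤1+n (ℕₚ.*-monoˡ-≤ 2 t≤h)))

-- The runs fill [0, h] and [h + R + 1, h + R + q], which leaves the middle block of [0, h + R + q].
-- Keeping `q` free serves both parities: `h` for even L, `suc h` for odd L.
gap : ∀ {U : Pred ℤ 0ℓ} h R q → U ≐ Descending h ∪ Ascending (suc (h ℕ.+ R)) q →
  [ 0ℤ ⋯ + (h ℕ.+ R ℕ.+ q) ]ℤ ∩ ∁ U ≐ [ + suc h ⋯ + (h ℕ.+ R) ]ℤ
gap {U} h R q (U⇒runs , runs⇒U) = to , from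
  where
  to : ∀ {x} → ([ 0ℤ ⋯ + (h ℕ.+ R ℕ.+ q) ]ℤ ∩ ∁ U) x → [ + suc h ⋯ + (h ℕ.+ R) ]ℤ x
  -- The lower bound 0 rules out negative labels.
  to {+ y} ((_ , +≤+ y≤N) , y∉U) = +≤+ (ℕₚ.≰⇒> h≱y) , +≤+ (ℕₚ.≮⇒≥ y≯h+R)
    where
    h≱y : ¬ (y ℕ.≤ h)
    h≱y y≤h = y∉U (runs⇒U (inj₁ (h ∸ y , ℕₚ.m∸n≤m h y , cong +_ (sym (ℕₚ.m∸[m∸n]≡n y≤h)))))
    y≯h+R : ¬ (h ℕ.+ R ℕ.< y)
    y≯h+R b≤y = y∉U (runs⇒U (inj₂ (y ∸ suc (h ℕ.+ R) , t<q , cong +_ (sym (ℕₚ.m+[n∸m]≡n b≤y)))))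
      where
      t<q : y ∸ suc (h ℕ.+ R) ℕ.< q
      t<q = ℕₚ.+-cancelˡ-≤ (h ℕ.+ R) _ _ (subst (ℕ._≤ h ℕ.+ R ℕ.+ q)
        (sym (trans (ℕₚ.+-suc (h ℕ.+ R) _) (ℕₚ.m+[n∸m]≡n b≤y))) y≤N)
  from : ∀ {x} → [ + suc h ⋯ + (h ℕ.+ R) ]ℤ x → ([ 0ℤ ⋯ + (h ℕ.+ R ℕ.+ q) ]ℤ ∩ ∁ U) x
  from {+ y} (+≤+ h<y , +≤+ y≤h+R) =
    (+≤+ z≤n , +≤+ (ℕₚ.m≤n⇒m≤n+o q y≤h+R)) , y∉U
    where
    y∉U : ¬ U (+ y)
    y∉U y∈U with U⇒runs y∈U
    ... | inj₁ (t , _ , refl) = ℕₚ.<⇒≱ h<y (ℕₚ.m∸n≤m h t)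
    ... | inj₂ (t , _ , refl) = ℕₚ.<⇒≱ (ℕₚ.m≤m+n (suc (h ℕ.+ R)) t) y≤h+R

gap-size : ∀ h R → + (h ℕ.+ R) ℤ.- + suc h ℤ.+ 1ℤ ≡ + R
gap-size h R = solve (+ h) (+ R)
  where
  solve : ∀ x y → x ℤ.+ y ℤ.- (1ℤ ℤ.+ x) ℤ.+ 1ℤ ≡ y
  solve = ℤ-Solver.solve-∀

-- Hub label and initial sign for each parity.

hubLabel-even : ∀ n h → hubLabel n (h ℕ.* 2) ≡ + h
hubLabel-even n h = trans
  (cong (if_then + (h ℕ.* 2 ℕ./ 2) else + n ℤ.- + ((h ℕ.* 2 ℕ.+ 1) ℕ./ 2))
    (dec-true (2 ∣? h ℕ.* 2) (divides h refl)))
  (cong +_ (m*n/n≡m h 2))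

initialSign-even : ∀ h → initialSign (h ℕ.* 2) ≡ Sign.+
initialSign-even h =
  cong (if_then Sign.+ else Sign.-) (dec-true (2 ∣? h ℕ.* 2) (divides h refl))

hubLabel-odd : ∀ R h → hubLabel (suc (R ℕ.+ suc (h ℕ.* 2))) (suc (h ℕ.* 2)) ≡ oddHub R h
hubLabel-odd R h = begin
  hubLabel n L
    ≡⟨ cong (if_then + (L ℕ./ 2) else + n ℤ.- + ((L ℕ.+ 1) ℕ./ 2))
         (dec-false (2 ∣? L) (2∤1+n*2 h)) ⟩
  + n ℤ.- + ((L ℕ.+ 1) ℕ./ 2)
    -- `1 + L` is `suc h * 2` by definition, so the division is exact.
    ≡⟨ cong (λ m → + n ℤ.- + (m ℕ./ 2)) (ℕₚ.+-comm L 1) ⟩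
  + n ℤ.- + (suc h ℕ.* 2 ℕ./ 2)
    ≡⟨ cong₂ (λ m k → + m ℤ.- + k) (rearrange R h) (m*n/n≡m (suc h) 2) ⟩
  + (suc (h ℕ.+ R) ℕ.+ suc h) ℤ.- + suc h
    ≡⟨ [m+n]-n≡m (suc (h ℕ.+ R)) (suc h) ⟩
  oddHub R h ∎
  where
  open ≡-Reasoning
  L = suc (h ℕ.* 2)
  n = suc (R ℕ.+ L)
  rearrange : ∀ R h → suc (R ℕ.+ suc (h ℕ.* 2)) ≡ suc (h ℕ.+ R) ℕ.+ suc h
  rearrange = ℕ-Solver.solve-∀

initialSign-odd : ∀ h → initialSign (suc (h ℕ.* 2)) ≡ Sign.-
initialSign-odd h =
  cong (if_then Sign.+ else Sign.-) (dec-false (2 ∣? suc (h ℕ.* 2)) (2∤1+n*2 h))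

UnusedInterval : ∀ {L} → (N R : ℕ) → (Fin (suc L) → ℤ) → Set
UnusedInterval {L} N R g = ∃₂ λ (A B : ℤ) →
  ([ 0ℤ ⋯ + N ]ℤ ∩ ∁ (Image g) ≐ [ A ⋯ B ]ℤ)
  × (B ℤ.- A ℤ.+ 1ℤ ≡ + R)
  × (2 ∣ L → g zero ≡ A ℤ.- 1ℤ)
  × (¬ (2 ∣ L) → g zero ≡ B ℤ.+ 1ℤ)

-- The interval is [h + 1, h + R] for either parity. The parity decides which end the hub touches,
-- and the clause for the other parity holds vacuously.
unusedInterval : ∀ R L (g : Fin (suc L) → ℤ) → g zero ≡ hubLabel (suc (R ℕ.+ L)) L →
  (∀ j → g j ≡ zigzag (g zero) (initialSign L) (suc R) (toℕ j)) →
  UnusedInterval (R ℕ.+ L) R g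
unusedInterval R L g g₀≡ g≡ with parity L
... | h , inj₁ refl = + suc h , + (h ℕ.+ R) ,
  subst (λ N → [ 0ℤ ⋯ + N ]ℤ ∩ ∁ (Image g) ≐ [ + suc h ⋯ + (h ℕ.+ R) ]ℤ) (rearrange h R)
    (gap h R h (evenWalk-image R h g λ j →
      trans (g≡ j) (cong₂ (λ c ε → zigzag c ε (suc R) (toℕ j)) g₀≡h (initialSign-even h)))) ,
  gap-size h R , (λ _ → g₀≡h) , λ 2∤ → contradiction (divides h refl) 2∤
  where
  g₀≡h = trans g₀≡ (hubLabel-even _ h)
  rearrange : ∀ h R → h ℕ.+ R ℕ.+ h ≡ R ℕ.+ h ℕ.* 2
  rearrange = ℕ-Solver.solve-∀
... | h , inj₂ refl = + suc h , + (h ℕ.+ R) ,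
  subst (λ N → [ 0ℤ ⋯ + N ]ℤ ∩ ∁ (Image g) ≐ [ + suc h ⋯ + (h ℕ.+ R) ]ℤ) (rearrange h R)
    (gap h R (suc h) (oddWalk-image R h g λ j →
      trans (g≡ j) (cong₂ (λ c ε → zigzag c ε (suc R) (toℕ j)) g₀≡H (initialSign-odd h)))) ,
  gap-size h R , (λ 2∣ → contradiction 2∣ (2∤1+n*2 h)) ,
  λ _ → trans g₀≡H (cong +_ (ℕₚ.+-comm 1 (h ℕ.+ R)))
  where
  g₀≡H = trans g₀≡ (hubLabel-odd R h)
  rearrange : ∀ h R → h ℕ.+ R ℕ.+ suc h ≡ R ℕ.+ suc (h ℕ.* 2)
  rearrange = ℕ-Solver.solve-∀

∁-initial : ∀ {D : Pred ℕ 0ℓ} R L → D ≐ [ suc R ⋯ R ℕ.+ L ]ℕ →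
  [ 1 ⋯ R ℕ.+ L ]ℕ ∩ ∁ D ≐ [ 1 ⋯ R ]ℕ
∁-initial R L (D⇒ , ⇒D) =
  (λ { ((1≤x , x≤N) , x∉D) → 1≤x , ℕₚ.≮⇒≥ λ R<x → x∉D (⇒D (R<x , x≤N)) }) ,
  (λ { (1≤x , x≤R) → (1≤x , ℕₚ.m≤n⇒m≤n+o L x≤R) , λ x∈D → let R<x , _ = D⇒ x∈D in ℕₚ.<⇒≱ R<x x≤R })

-- The theorem for a bare function on the positions of the path. With `N` a variable, its equation
-- can be matched by `refl`, after which `suc N ∸ L` simplifies to `suc R`.
arm-labels : ∀ N R L → N ≡ R ℕ.+ L → (g : Fin (suc L) → ℤ) →
  g zero ≡ hubLabel (suc N) L →
  tabulate (g ∘ suc) ≡ armWalk (hubLabel (suc N) L) (topDifferences (suc N) L) (initialSign L) (suc N) →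
  (Difference g ≐ [ suc N ∸ L ⋯ N ]ℕ)
  × UnusedInterval N R g
  × ([ 1 ⋯ N ]ℕ ∩ ∁ (Difference g) ≐ [ 1 ⋯ R ]ℕ)
arm-labels N R L refl g g₀≡ walk =
  subst (λ d → Difference g ≐ [ d ⋯ N ]ℕ) (sym n∸L≡1+R) differences ,
  unusedInterval R L g g₀≡ (steps⇒zigzag (initialSign L) (suc R) g steps) ,
  ∁-initial R L differences
  where
  n∸L≡1+R : suc N ∸ L ≡ suc R
  n∸L≡1+R = ℕₚ.m+n∸n≡m (suc R) L
  steps : ∀ j → g (suc j) ≡ g (inject₁ j) ℤ.+ step (initialSign L) (suc R) (toℕ j)
  steps j = subst (λ d → g (suc j) ≡ g (inject₁ j) ℤ.+ step (initialSign L) d (toℕ j)) n∸L≡1+R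
    (armWalk-step (suc N) L (initialSign L) g
      (trans walk (cong (λ c → armWalk c (topDifferences (suc N) L) (initialSign L) (suc N)) (sym g₀≡))) j)
  differences : Difference g ≐ [ suc R ⋯ N ]ℕ
  differences = Differences-zigzag (initialSign L) R g steps

lemma3p1 :
  (m : ℕ) → let k = suc m in 3 ℕ.≤ k →
  (ℓ : Vector ℕ k) →
  1 ℕ.≤ ℓ zero → (∀ i j → i Fin.≤ j → ℓ i ℕ.≤ ℓ j) →
  let last = fromℕ m
      L    = ℓ last
      n    = order ℓ
      R    = n ∸ 1 ∸ L
      H    = hubLabel n L
  in
  (f : Labelling ℓ) →
  f hub ≡ H →
  tabulate (λ j → f (arm last j))
    ≡ armWalk H (topDifferences n L) (initialSign L) n →
  (UsedDifference f last ≐ [ n ∸ L ⋯ n ∸ 1 ]ℕ)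
  × (∃₂ λ (A B : ℤ) →
       ([ 0ℤ ⋯ + n ℤ.- 1ℤ ]ℤ ∩ ∁ (UsedLabel f last) ≐ [ A ⋯ B ]ℤ)
       × (B ℤ.- A ℤ.+ 1ℤ ≡ + R)
       × (2 ∣ L → H ≡ A ℤ.- 1ℤ)
       × (¬ (2 ∣ L) → H ≡ B ℤ.+ 1ℤ))
  × ([ 1 ⋯ n ∸ 1 ]ℕ ∩ ∁ (UsedDifference f last) ≐ [ 1 ⋯ R ]ℕ)
lemma3p1 m _ ℓ _ _ f f-hub f-arm =
  let N = foldr ℕ._+_ 0 ℓ
      L = ℓ (fromℕ m)
      diffs , (A , B , interval , size , even , odd) , rest =
        -- One arm is at most the sum of all arms, so `N ∸ L` is a true difference. Both `n ∸ 1` and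
        -- `+ n - 1ℤ` reduce to `N`.
        arm-labels N (N ∸ L) L (sym (ℕₚ.m∸n+n≡m (lookup≤foldr-+ ℓ (fromℕ m))))
          (f ∘ path (fromℕ m)) f-hub f-arm
  in diffs ,
     (A , B , interval , size , trans (sym f-hub) ∘ even , trans (sym f-hub) ∘ odd) ,
     rest
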